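{- Let $G$ be a finite simple graph, and let $s \colon E(G) \to \{1,2,3,\dotsc\}$ be any function from the edges of $G$ to the positive integers. Let $G'$ be obtained from $G$ by making $s(e)$ many subdivisions of each edge $e \in E(G)$. Then $\mu_g(G') \le 3$.
   Context: Making $s$ many subdivisions of an edge $uv$ means replacing it by a path from $u$ to $v$ with exactly $s$ new internal vertices (each of degree $2$). Majority coloring game: given a graph $G$ and a palette of $k$ colors, two players Alice and Bob alternately (Alice first) choose an uncolored vertex of $G$ and assign it a color from the palette, so that after every move the majority condition holds: for every colored vertex $v$, at most $\deg(v)/2$ of the neighbors of $v$ have the same color as $v$. (Uncolored vertices impose no condition; $\deg(v)$ is the degree in the whole graph $G$.) Alice wins if all vertices get colored; Bob wins if at some point there is an uncolored vertex to which no color of the palette can be legally assigned. The majority game chromatic number $\mu_g(G)$ is the least $k$ such that Alice has a winning strategy with a palette of $k$ colors. -}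

module Defs where

open import Data.Bool using (if_then_else_)
open import Data.Empty using (⊥)
open import Data.Fin as Fin using (Fin; toℕ)
import Data.Fin.Properties as Fin
open import Data.List using (List; []; _∷_; _++_; map; concatMap; filter; length; lookup; allFin)
open import Data.List.Membership.Propositional using (_∈_; lose)
open import Data.List.Membership.Propositional.Properties
  using (∈-map⁺; ∈-map⁻; ∈-++⁺ˡ; ∈-++⁺ʳ; ∈-concatMap⁺; ∈-concatMap⁻; ∈-allFin)
open import Data.List.Relation.Unary.All using (All; []; _∷_)
open import Data.List.Relation.Unary.Any using (Any; here; there; index; any?; satisfied)
open import Data.List.Relation.Unary.Any.Properties using (lookup-index)
open import Data.List.Relation.Unary.Unique.Propositional using (Unique; []; _∷_)
import Data.List.Relation.Unary.Unique.Propositional.Properties as Unique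
open import Data.Maybe using (Maybe; just; nothing)
open import Data.Maybe.Properties using (≡-dec)
open import Data.Nat using (ℕ; suc; _*_; _≤_; _<_)
import Data.Nat.Properties as ℕ
open import Data.Product using (∃-syntax; _×_; _,_; proj₁; proj₂)
open import Data.Sum using (_⊎_; inj₁; inj₂; swap)
open import Relation.Binary using (Decidable; DecidableEquality; Symmetric; Irreflexive)
open import Relation.Binary.PropositionalEquality using (_≡_; refl; sym; trans; cong)
open import Relation.Nullary using (¬_; Dec; yes; no; does)
open import Relation.Nullary.Decidable using (map′; recompute; _×-dec_; _⊎-dec_)

record Enumeration (A : Set) : Set where
  field
    elements : List A
    complete : ∀ x → x ∈ elements
    unique   : Unique elements

  rank : A → ℕ
  rank x = toℕ (index (complete x))

  rank-injective : ∀ {x y} → rank x ≡ rank y → x ≡ y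
  rank-injective {x} {y} eq =
    trans (lookup-index (complete x))
      (trans (cong (lookup elements) (Fin.toℕ-injective eq))
        (sym (lookup-index (complete y))))

  _≟_ : DecidableEquality A
  x ≟ y = map′ rank-injective (cong rank) (rank x ℕ.≟ rank y)

record FiniteSimpleGraph : Set₁ where
  field
    V          : Set
    finite     : Enumeration V
    Adj        : V → V → Set
    adj?       : Decidable Adj
    adj-sym    : Symmetric Adj
    adj-irrefl : Irreflexive _≡_ Adj

  open Enumeration finite public
    renaming (elements to vertices)

  deg : V → ℕ
  deg v = length (filter (adj? v) vertices)

  -- Every undirected edge occurs exactly once, listed from its endpoint of
  -- smaller rank; irrelevance of the proofs makes an edge determined by its
  -- endpoints.
  record Edge : Set where
    constructor edge
    field
      src tgt   : V
      .src<tgt  : rank src < rank tgt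
      .adjacent : Adj src tgt

private
  unique-concatMap : ∀ {A B : Set} (f : A → List B) →
    (∀ x → Unique (f x)) →
    (∀ {x y b} → b ∈ f x → b ∈ f y → x ≡ y) →
    ∀ {xs} → Unique xs → Unique (concatMap f xs)
  unique-concatMap f uf key [] = []
  unique-concatMap f uf key {x ∷ xs} (x∉ ∷ uxs) =
    Unique.++⁺ (uf x) (unique-concatMap f uf key uxs) disjoint
    where
    disjoint : ∀ {b} → ¬ (b ∈ f x × b ∈ concatMap f xs)
    disjoint (p , q) = go x∉ (∈-concatMap⁻ f q)
      where
      go : ∀ {ys} → All (λ y → ¬ x ≡ y) ys → ¬ Any (λ y → _ ∈ f y) ys
      go (x≢y ∷ _) (here r)  = x≢y (key p r)
      go (_ ∷ ns)  (there r) = go ns r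

module _ (G : FiniteSimpleGraph) where
  open FiniteSimpleGraph G
  open Edge

  private
    fromDec : ∀ {u v} → Dec (rank u < rank v × Adj u v) → List Edge
    fromDec {u} {v} (yes (lt , a)) = edge u v lt a ∷ []
    fromDec         (no _)         = []

    edge? : ∀ u v → Dec (rank u < rank v × Adj u v)
    edge? u v = (rank u ℕ.<? rank v) ×-dec adj? u v

    between : V → V → List Edge
    between u v = fromDec (edge? u v)

    from : V → List Edge
    from u = concatMap (between u) vertices

    fromDec-ends : ∀ {u v e} (d : Dec (rank u < rank v × Adj u v)) →
      e ∈ fromDec d → src e ≡ u × tgt e ≡ v
    fromDec-ends (yes _) (here refl) = refl , refl

    fromDec-unique : ∀ {u v} (d : Dec (rank u < rank v × Adj u v)) → Unique (fromDec d)
    fromDec-unique (yes _) = [] ∷ []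
    fromDec-unique (no _)  = []

    ∈-fromDec : ∀ e (d : Dec (rank (src e) < rank (tgt e) × Adj (src e) (tgt e))) →
      e ∈ fromDec d
    ∈-fromDec e               (yes _) = here refl
    ∈-fromDec (edge _ _ lt a) (no ¬p) = ⊥-elim-irr (¬p (lt , a))
      where
      ⊥-elim-irr : ∀ {A : Set} → .⊥ → A
      ⊥-elim-irr ()

    ends : ∀ {u v e} → e ∈ between u v → src e ≡ u × tgt e ≡ v
    ends {u} {v} = fromDec-ends (edge? u v)

    from-src : ∀ {u e} → e ∈ from u → src e ≡ u
    from-src {u} p = proj₁ (ends (proj₂ (satisfied (∈-concatMap⁻ (between u) {xs = vertices} p))))

  edges : Enumeration Edge
  edges = record
    { elements = concatMap from vertices
    ; complete = λ e →
        ∈-concatMap⁺ from (lose (complete (src e))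
          (∈-concatMap⁺ (between (src e)) (lose (complete (tgt e))
            (∈-fromDec e (edge? (src e) (tgt e))))))
    ; unique   = unique-concatMap from
        (λ u → unique-concatMap (between u)
          (λ v → fromDec-unique (edge? u v))
          (λ p q → trans (sym (proj₂ (ends p))) (proj₂ (ends q)))
          unique)
        (λ p q → trans (sym (from-src p)) (from-src q))
        unique
    }

-- The edge e becomes the path
--   old (src e) , new e 0 , … , new e (s e - 1) , old (tgt e).
module Subdivision (G : FiniteSimpleGraph) (s : FiniteSimpleGraph.Edge G → ℕ) where
  open FiniteSimpleGraph G
  open Edge

  data SubVertex : Set where
    old : V → SubVertex
    new : (e : Edge) → Fin (s e) → SubVertex

  data _⟶_ : SubVertex → SubVertex → Set where
    direct : ∀ e → s e ≡ 0 → old (src e) ⟶ old (tgt e)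
    enter  : ∀ e i → toℕ i ≡ 0 → old (src e) ⟶ new e i
    step   : ∀ e i j → toℕ j ≡ suc (toℕ i) → new e i ⟶ new e j
    leave  : ∀ e i → suc (toℕ i) ≡ s e → new e i ⟶ old (tgt e)

  SubAdj : SubVertex → SubVertex → Set
  SubAdj x y = x ⟶ y ⊎ y ⟶ x

  module E = Enumeration (edges G)

  collapse : ∀ {u v} → ∃[ e ] (src e ≡ u × tgt e ≡ v × s e ≡ 0) → old u ⟶ old v
  collapse (e , refl , refl , z) = direct e z

  _⟶?_ : Decidable _⟶_
  old u ⟶? old v = map′
    (λ p → collapse (satisfied p))
    (λ { (direct e z) → lose (E.complete e) (refl , refl , z) })
    (any? (λ e → (src e ≟ u) ×-dec (tgt e ≟ v) ×-dec (s e ℕ.≟ 0)) E.elements)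
  old u ⟶? new e i = map′
    (λ { (refl , z) → enter e i z })
    (λ { (enter _ _ z) → refl , z })
    ((src e ≟ u) ×-dec (toℕ i ℕ.≟ 0))
  new e i ⟶? old v = map′
    (λ { (refl , l) → leave e i l })
    (λ { (leave _ _ l) → refl , l })
    ((tgt e ≟ v) ×-dec (suc (toℕ i) ℕ.≟ s e))
  new e i ⟶? new f j with e E.≟ f
  ... | no e≢f  = no λ { (step _ _ _ _) → e≢f refl }
  ... | yes refl = map′ (step e i j) (λ { (step _ _ _ q) → q }) (toℕ j ℕ.≟ suc (toℕ i))

  src≢tgt : ∀ e → ¬ src e ≡ tgt e
  src≢tgt (edge u v lt _) eq =
    ℕ.<-irrefl (cong rank eq) (recompute (rank u ℕ.<? rank v) lt)

  no-loop : ∀ {x y} → x ≡ y → ¬ x ⟶ y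
  no-loop eq (direct e _)   = src≢tgt e (old-injective eq)
    where
    old-injective : ∀ {u v} → old u ≡ old v → u ≡ v
    old-injective refl = refl
  no-loop () (enter _ _ _)
  no-loop refl (step _ _ _ q) = ℕ.1+n≢n (sym q)
  no-loop () (leave _ _ _)

  news : Edge → List SubVertex
  news e = map (new e) (allFin (s e))

  newEdge : ∀ {e f i j} → new e i ≡ new f j → e ≡ f
  newEdge refl = refl

  new-injective : ∀ {e i j} → new e i ≡ new e j → i ≡ j
  new-injective refl = refl

  old≢new : ∀ {u e i} → ¬ old u ≡ new e i
  old≢new ()

  news-inv : ∀ {x} e → x ∈ news e → ∃[ i ] x ≡ new e i
  news-inv e p with ∈-map⁻ (new e) p
  ... | i , _ , eq = i , eq

  subVertices : Enumeration SubVertex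
  subVertices = record
    { elements = map old vertices ++ concatMap news E.elements
    ; complete = λ
        { (old v)   → ∈-++⁺ˡ (∈-map⁺ old (complete v))
        ; (new e i) → ∈-++⁺ʳ (map old vertices)
            (∈-concatMap⁺ news (lose (E.complete e) (∈-map⁺ (new e) (∈-allFin i))))
        }
    ; unique   = Unique.++⁺
        (Unique.map⁺ (λ { refl → refl }) unique)
        (unique-concatMap news
          (λ e → Unique.map⁺ new-injective (Unique.allFin⁺ (s e)))
          (λ {e} {f} p q →
            newEdge (trans (sym (proj₂ (news-inv e p))) (proj₂ (news-inv f q))))
          E.unique)
        (λ (p , q) →
          let (_ , _ , eq) = ∈-map⁻ old p
              (e , r)      = satisfied (∈-concatMap⁻ news {xs = E.elements} q)
          in old≢new (trans (sym eq) (proj₂ (news-inv e r))))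
    }

  subdivide : FiniteSimpleGraph
  subdivide = record
    { V          = SubVertex
    ; finite     = subVertices
    ; Adj        = SubAdj
    ; adj?       = λ x y → (x ⟶? y) ⊎-dec (y ⟶? x)
    ; adj-sym    = swap
    ; adj-irrefl = λ { eq (inj₁ p) → no-loop eq p ; eq (inj₂ p) → no-loop (sym eq) p }
    }

open Subdivision public using (subdivide)

module MajorityGame (G : FiniteSimpleGraph) (k : ℕ) where
  open FiniteSimpleGraph G

  Color : Set
  Color = Fin k

  Position : Set
  Position = V → Maybe Color

  initial : Position
  initial _ = nothing

  _[_≔_] : Position → V → Color → Position
  (p [ v ≔ c ]) u = if does (u ≟ v) then just c else p u

  neighborsColored : Position → V → Color → ℕ
  neighborsColored p v c =
    length (filter (λ u → adj? v u ×-dec ≡-dec Fin._≟_ (p u) (just c)) vertices)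

  Majority : Position → Set
  Majority p = ∀ v c → p v ≡ just c → 2 * neighborsColored p v c ≤ deg v

  Legal : Position → V → Color → Set
  Legal p v c = p v ≡ nothing × Majority (p [ v ≔ c ])

  AllColored : Position → Set
  AllColored p = ∀ v → ∃[ c ] p v ≡ just c

  BobHasWon : Position → Set
  BobHasWon p = ∃[ v ] (p v ≡ nothing × (∀ c → ¬ Legal p v c))

  data Player : Set where
    alice bob : Player

  -- An inhabitant of WinsFrom t p is a winning strategy for Alice from p
  -- with player t to move.
  data WinsFrom : Player → Position → Set where
    finished  : ∀ {t p} → AllColored p → WinsFrom t p
    aliceMove : ∀ {p} → ¬ BobHasWon p →
                ∀ v c → Legal p v c → WinsFrom bob (p [ v ≔ c ]) →
                WinsFrom alice p
    bobMove   : ∀ {p} → ¬ BobHasWon p →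
                (∀ v c → Legal p v c → WinsFrom alice (p [ v ≔ c ])) →
                WinsFrom bob p

  AliceWins : Set
  AliceWins = WinsFrom alice initial

open MajorityGame public using (AliceWins)

IsLeast : (ℕ → Set) → ℕ → Set
IsLeast P k = P k × (∀ j → P j → k ≤ j)

-- μ_g(G) = k
IsMajorityGameChromaticNumber : FiniteSimpleGraph → ℕ → Set
IsMajorityGameChromaticNumber G = IsLeast (AliceWins G)

{-# OPTIONS --safe #-}

-- After subdividing, the old vertices are independent and every new vertex has
-- exactly two neighbours.  With three colours a new vertex can always avoid the
-- colours of both its neighbours.  An old vertex v loses at most one colour by
-- majority among its own neighbours; any other colour d is lost only through a
-- neighbour coloured d whose second neighbour is also coloured d.  Alice keeps
-- the invariant that each coloured neighbour of an uncoloured old vertex v has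
-- its second neighbour already coloured differently.  Bob can break it only at
-- the vertex w he has just coloured, by colouring it next to an uncoloured old
-- vertex; Alice restores it by giving such a neighbour of w a colour other than
-- that of w.
module Submission where

open import Defs
open import Data.Bool using (if_then_else_)
open import Data.Empty using (⊥-elim)
open import Data.Fin using (Fin; zero; suc; toℕ; fromℕ<)
import Data.Fin.Properties as Fin
open import Data.List using ([]; _∷_; filter; length)
open import Data.List.Membership.Propositional using (_∈_; lose)
open import Data.List.Membership.Propositional.Properties using (∈-filter⁺; ∈-filter⁻)
open import Data.List.Properties using (filter-none)
open import Data.List.Relation.Binary.Sublist.Propositional using (⊆-refl)
import Data.List.Relation.Binary.Sublist.Propositional.Properties as Sublist
open import Data.List.Relation.Unary.All as All using ([]; _∷_)
open import Data.List.Relation.Unary.Any using (here; there; any?; satisfied)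
open import Data.List.Relation.Unary.Unique.Propositional using (Unique; []; _∷_)
import Data.List.Relation.Unary.Unique.Propositional.Properties as Unique
open import Data.Maybe using (just; nothing)
open import Data.Maybe.Properties using (≡-dec; just-injective)
open import Data.Nat using (ℕ; zero; suc; _+_; _*_; _≤_; _<_; z≤n; s≤s; s≤s⁻¹)
import Data.Nat.Properties as ℕ
open import Data.Product using (∃-syntax; _×_; _,_; proj₁; proj₂)
open import Data.Sum using (_⊎_; inj₁; inj₂)
open import Relation.Binary.PropositionalEquality using (_≡_; _≢_; refl; sym; trans; cong; subst)
open import Relation.Nullary using (¬_; Dec; yes; no)
open import Relation.Nullary.Decidable using (map′; dec-true; dec-false; _×-dec_; _→-dec_; ¬?; decidable-stable)
open import Relation.Unary using (Decidable; ∅; ｛_｝; _∪_; _∉_)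

-- Counting with filtered lists, finite search and least witnesses.

module _ {A : Set} {P Q R : A → Set} (P? : Decidable P) (Q? : Decidable Q) (R? : Decidable R) where

  length-filter-disjoint : (∀ {x} → P x → ¬ Q x) → (∀ {x} → P x → R x) → (∀ {x} → Q x → R x) →
    ∀ xs → length (filter P? xs) + length (filter Q? xs) ≤ length (filter R? xs)
  length-filter-disjoint dis P⊆R Q⊆R [] = z≤n
  length-filter-disjoint dis P⊆R Q⊆R (x ∷ xs)
    with P? x | Q? x | R? x | length-filter-disjoint dis P⊆R Q⊆R xs
  ... | yes p | yes q | _     | ih = ⊥-elim (dis p q)
  ... | yes p | no _  | yes _ | ih = s≤s ih
  ... | yes p | no _  | no ¬r | ih = ⊥-elim (¬r (P⊆R p))
  ... | no _  | yes q | no ¬r | ih = ⊥-elim (¬r (Q⊆R q))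
  ... | no _  | yes _ | yes _ | ih = ℕ.≤-trans (ℕ.≤-reflexive (ℕ.+-suc _ _)) (s≤s ih)
  ... | no _  | no _  | yes _ | ih = ℕ.m≤n⇒m≤1+n ih
  ... | no _  | no _  | no _  | ih = ih

module _ {A : Set} {P Q : A → Set} (P? : Decidable P) (Q? : Decidable Q) where

  length-filter-mono : (∀ {x} → P x → Q x) → ∀ xs → length (filter P? xs) ≤ length (filter Q? xs)
  length-filter-mono P⊆Q xs =
    Sublist.length-mono-≤ (Sublist.filter⁺ P? Q? (λ { refl → P⊆Q }) (⊆-refl {x = xs}))

∈⇒1≤length : ∀ {A : Set} {x : A} {xs} → x ∈ xs → 1 ≤ length xs
∈⇒1≤length (here _)  = s≤s z≤n
∈⇒1≤length (there _) = s≤s z≤n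

∈-distinct⇒2≤length : ∀ {A : Set} {x y : A} {xs} → x ∈ xs → y ∈ xs → x ≢ y → 2 ≤ length xs
∈-distinct⇒2≤length (here p)  (here q)  x≢y = ⊥-elim (x≢y (trans p (sym q)))
∈-distinct⇒2≤length (here _)  (there q) _   = s≤s (∈⇒1≤length q)
∈-distinct⇒2≤length (there p) _         _   = s≤s (∈⇒1≤length p)

unique-constant⇒length≤1 : ∀ {A : Set} {a : A} {xs} → Unique xs → (∀ {x} → x ∈ xs → x ≡ a) →
  length xs ≤ 1
unique-constant⇒length≤1 []                      _  = z≤n
unique-constant⇒length≤1 (_ ∷ [])                _  = s≤s z≤n
unique-constant⇒length≤1 ((x≢y ∷ _) ∷ (_ ∷ _)) eq =
  ⊥-elim (x≢y (trans (eq (here refl)) (sym (eq (there (here refl))))))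

module _ {A : Set} (enum : Enumeration A) {P : A → Set} (P? : Decidable P) where
  open Enumeration enum

  ∃? : Dec (∃[ x ] P x)
  ∃? = map′ satisfied (λ (x , px) → lose (complete x) px) (any? P? elements)

  ∀? : Dec (∀ x → P x)
  ∀? = map′ (λ ps x → All.lookup ps (complete x)) (λ f → All.tabulate (λ {x} _ → f x))
    (All.all? P? elements)

2*m≤o : ∀ {m n o} → m ≤ n → m + n ≤ o → 2 * m ≤ o
2*m≤o {m} m≤n rewrite ℕ.+-identityʳ m = ℕ.≤-trans (ℕ.+-monoʳ-≤ m m≤n)

-- Constructively, a least witness needs a decidable predicate, which is why the game is decided
-- below. Recursing on the predicate shifted by one amounts to searching upwards from zero.
isLeast-≤ : ∀ {P : ℕ → Set} → (∀ k → Dec (P k)) → ∀ n → P n → ∃[ k ] (IsLeast P k × k ≤ n)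
isLeast-≤ P? zero    pn = zero , (pn , λ _ _ → z≤n) , z≤n
isLeast-≤ P? (suc n) pn with P? zero
... | yes p0 = zero , (p0 , λ _ _ → z≤n) , z≤n
... | no ¬p0 with isLeast-≤ (λ k → P? (suc k)) n pn
...   | k , (pk , least) , k≤n =
  suc k , (pk , λ { zero p0 → ⊥-elim (¬p0 p0) ; (suc j) pj → s≤s (least j pj) }) , s≤s k≤n

-- Positions and the decidability of the game

module Positions (G : FiniteSimpleGraph) (k : ℕ) where
  open FiniteSimpleGraph G
  open MajorityGame G k hiding (AliceWins)

  coloredAs? : ∀ (p : Position) v c → Decidable (λ u → Adj v u × p u ≡ just c)
  coloredAs? p v c u = adj? v u ×-dec ≡-dec Fin._≟_ (p u) (just c)

  uncolored? : (p : Position) → Decidable (λ v → p v ≡ nothing)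
  uncolored? p v = ≡-dec Fin._≟_ (p v) nothing

  uncolored : Position → ℕ
  uncolored p = length (filter (uncolored? p) vertices)

  colored-or-uncolored : ∀ (p : Position) v → (∃[ c ] p v ≡ just c) ⊎ p v ≡ nothing
  colored-or-uncolored p v with p v
  ... | just c  = inj₁ (c , refl)
  ... | nothing = inj₂ refl

  colored≢uncolored : ∀ {p : Position} {v c} → p v ≡ just c → p v ≢ nothing
  colored≢uncolored eq eq′ with trans (sym eq) eq′
  ... | ()

  module _ (p : Position) (v : V) (c : Color) where

    update-same : (p [ v ≔ c ]) v ≡ just c
    update-same = cong (λ b → if b then just c else p v) (dec-true (v ≟ v) refl)

    update-other : ∀ {u} → u ≢ v → (p [ v ≔ c ]) u ≡ p u
    update-other {u} u≢v = cong (λ b → if b then just c else p u) (dec-false (u ≟ v) u≢v)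

    update-uncolored : ∀ {u} → (p [ v ≔ c ]) u ≡ nothing → u ≢ v × p u ≡ nothing
    update-uncolored eq = u≢v , trans (sym (update-other u≢v)) eq
      where
      u≢v : _ ≢ v
      u≢v refl = colored≢uncolored {p [ v ≔ c ]} update-same eq

    -- The vertices uncolored after the move and `v` itself form disjoint sets of vertices uncolored
    -- before. This count decreases in every recursion on the game.
    uncolored-update : p v ≡ nothing → uncolored (p [ v ≔ c ]) < uncolored p
    uncolored-update pv = begin
      suc (uncolored (p [ v ≔ c ])) ≡⟨ ℕ.+-comm 1 _ ⟩
      uncolored (p [ v ≔ c ]) + 1
        ≤⟨ ℕ.+-monoʳ-≤ _ (∈⇒1≤length (∈-filter⁺ (_≟ v) (complete v) refl)) ⟩
      uncolored (p [ v ≔ c ]) + length (filter (_≟ v) vertices)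
        ≤⟨ length-filter-disjoint (uncolored? (p [ v ≔ c ])) (_≟ v) (uncolored? p)
             (λ eq → proj₁ (update-uncolored eq))
             (λ eq → proj₂ (update-uncolored eq))
             (λ { refl → pv }) vertices ⟩
      uncolored p ∎
      where open ℕ.≤-Reasoning

  majority? : ∀ p → Dec (Majority p)
  majority? p = ∀? finite λ v → Fin.all? λ c →
    ≡-dec Fin._≟_ (p v) (just c) →-dec (2 * neighborsColored p v c ℕ.≤? deg v)

  legal? : ∀ p v c → Dec (Legal p v c)
  legal? p v c = uncolored? p v ×-dec majority? (p [ v ≔ c ])

  uncolored-vertex? : ∀ p → Dec (∃[ v ] p v ≡ nothing)
  uncolored-vertex? p = ∃? finite (uncolored? p)

  ¬uncolored⇒allColored : ∀ {p} → ¬ (∃[ v ] p v ≡ nothing) → AllColored p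
  ¬uncolored⇒allColored {p} none v with colored-or-uncolored p v
  ... | inj₁ c = c
  ... | inj₂ n = ⊥-elim (none (v , n))

  allColored? : ∀ p → Dec (AllColored p)
  allColored? p = map′ ¬uncolored⇒allColored
    (λ all (v , eq) → colored≢uncolored {p} (proj₂ (all v)) eq)
    (¬? (uncolored-vertex? p))

  bobHasWon? : ∀ p → Dec (BobHasWon p)
  bobHasWon? p = ∃? finite λ v → uncolored? p v ×-dec Fin.all? (λ c → ¬? (legal? p v c))

  -- The game tree is searched exhaustively. `n` strictly bounds the number of uncolored vertices,
  -- and each legal move lowers that number, so the recursion is structural in `n`.
  wins? : ∀ n t p → uncolored p < n → Dec (WinsFrom t p)
  wins? (suc n) t p u<n with allColored? p | bobHasWon? p
  ... | yes all | _      = yes (finished all)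
  ... | no ¬all | yes bw = no λ
    { (finished all)        → ¬all all
    ; (aliceMove ¬bw _ _ _ _) → ¬bw bw
    ; (bobMove ¬bw _)       → ¬bw bw
    }
  -- The game is still undecided, so a strategy can only begin with the move constructor of player
  -- `t`.
  ... | no ¬all | no ¬bw = next t
    where
    after : ∀ t′ v c → Legal p v c → Dec (WinsFrom t′ (p [ v ≔ c ]))
    after t′ v c (pv , _) =
      wins? n t′ (p [ v ≔ c ]) (ℕ.<-≤-trans (uncolored-update p v c pv) (s≤s⁻¹ u<n))

    good? : ∀ v c → Dec (Legal p v c × WinsFrom bob (p [ v ≔ c ]))
    good? v c with legal? p v c
    ... | no ¬l = no λ (l , _) → ¬l l
    ... | yes l = map′ (l ,_) proj₂ (after bob v c l)

    answered? : ∀ v c → Dec (Legal p v c → WinsFrom alice (p [ v ≔ c ]))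
    answered? v c with legal? p v c
    ... | no ¬l = yes λ l → ⊥-elim (¬l l)
    ... | yes l = map′ (λ w _ → w) (λ f → f l) (after alice v c l)

    next : ∀ t → Dec (WinsFrom t p)
    next alice = map′
      (λ (v , c , l , w) → aliceMove ¬bw v c l w)
      (λ { (finished all) → ⊥-elim (¬all all) ; (aliceMove _ v c l w) → v , c , l , w })
      (∃? finite λ v → Fin.any? (good? v))
    next bob = map′
      (bobMove ¬bw)
      (λ { (finished all) → ⊥-elim (¬all all) ; (bobMove _ f) → f })
      (∀? finite λ v → Fin.all? (answered? v))

  aliceWins? : Dec (AliceWins G k)
  aliceWins? = wins? (suc (uncolored initial)) alice initial ℕ.≤-refl

-- Alice's strategy

record NeighborPair (G : FiniteSimpleGraph) (w : FiniteSimpleGraph.V G) : Set where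
  open FiniteSimpleGraph G
  field
    fst snd  : V
    distinct : fst ≢ snd
    adj-fst  : Adj w fst
    adj-snd  : Adj w snd
    only     : ∀ {x} → Adj w x → x ≡ fst ⊎ x ≡ snd

  2≤deg : 2 ≤ deg w
  2≤deg = ∈-distinct⇒2≤length
    (∈-filter⁺ (adj? w) (complete fst) adj-fst)
    (∈-filter⁺ (adj? w) (complete snd) adj-snd)
    distinct

  other : ∀ {x y z} → Adj w x → Adj w y → Adj w z → x ≢ y → z ≢ y → z ≡ x
  other ax ay az x≢y z≢y with only ax | only ay | only az
  ... | inj₁ refl | inj₁ refl | _         = ⊥-elim (x≢y refl)
  ... | inj₂ refl | inj₂ refl | _         = ⊥-elim (x≢y refl)
  ... | inj₁ refl | inj₂ refl | inj₁ refl = refl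
  ... | inj₁ refl | inj₂ refl | inj₂ refl = ⊥-elim (z≢y refl)
  ... | inj₂ refl | inj₁ refl | inj₂ refl = refl
  ... | inj₂ refl | inj₁ refl | inj₁ refl = ⊥-elim (z≢y refl)

third : (c d : Fin 3) → ∃[ e ] (e ≢ c × e ≢ d)
third zero             zero             = suc zero , (λ ()) , (λ ())
third zero             (suc zero)       = suc (suc zero) , (λ ()) , (λ ())
third zero             (suc (suc zero)) = suc zero , (λ ()) , (λ ())
third (suc zero)       zero             = suc (suc zero) , (λ ()) , (λ ())
third (suc zero)       (suc zero)       = zero , (λ ()) , (λ ())
third (suc zero)       (suc (suc zero)) = zero , (λ ()) , (λ ())
third (suc (suc zero)) zero             = suc zero , (λ ()) , (λ ())
third (suc (suc zero)) (suc zero)       = zero , (λ ()) , (λ ())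
third (suc (suc zero)) (suc (suc zero)) = zero , (λ ()) , (λ ())

-- The strategy sees only an independent set `Old` whose complement consists of vertices of degree
-- two. Vertices outside `Old` may be adjacent to each other, as when an edge is subdivided
-- repeatedly.
module Strategy
  (G : FiniteSimpleGraph)
  (Old : FiniteSimpleGraph.V G → Set)
  (old? : Decidable Old)
  (old-independent : ∀ {u v} → Old u → Old v → ¬ FiniteSimpleGraph.Adj G u v)
  (pairs : ∀ {w} → ¬ Old w → NeighborPair G w)
  where
  open FiniteSimpleGraph G
  open MajorityGame G 3 hiding (AliceWins)
  open Positions G 3

  -- Sufficient conditions for a legal move.

  old-neighbor : ∀ {v w} → Old v → Adj v w → ¬ Old w
  old-neighbor ov a ow = old-independent ov ow a

  -- The move affects the majority condition only at `v`, where the bound on `neighborsColored`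
  -- applies, and at neighbours of `v` coloured `d`. By the last hypothesis `v` becomes the only
  -- neighbour of colour `d` of such a vertex, which degree at least two permits.
  legal-intro : ∀ p v d → p v ≡ nothing → Majority p →
    2 * neighborsColored p v d ≤ deg v →
    (∀ {w} → Adj v w → p w ≡ just d →
      2 ≤ deg w × (∀ {y} → Adj w y → y ≢ v → p y ≢ just d)) →
    Legal p v d
  legal-intro p v d pv maj few room = pv , majority
    where
    p′ : Position
    p′ = p [ v ≔ d ]

    mono : ∀ {u c} → (∀ {x} → Adj u x × p′ x ≡ just c → p x ≡ just c) →
      2 * neighborsColored p u c ≤ deg u → 2 * neighborsColored p′ u c ≤ deg u
    mono {u} {c} f = ℕ.≤-trans (ℕ.*-monoʳ-≤ 2
      (length-filter-mono (coloredAs? p′ u c) (coloredAs? p u c) (λ q → proj₁ q , f q) vertices))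

    majority : Majority p′
    majority u c eq with u ≟ v
    ... | yes refl with just-injective (trans (sym (update-same p v d)) eq)
    ...   | refl =
      mono (λ (a , e) → trans (sym (update-other p v d λ { refl → adj-irrefl refl a })) e) few
    majority u c eq | no u≢v with trans (sym (update-other p v d u≢v)) eq | adj? v u | c Fin.≟ d
    ... | pu | no ¬a | _ =
      mono (λ (a , e) → trans (sym (update-other p v d λ { refl → ¬a (adj-sym a) })) e) (maj u c pu)
    ... | pu | yes _ | no c≢d =
      mono (λ (_ , e) → trans (sym (update-other p v d λ { refl →
        c≢d (just-injective (trans (sym e) (update-same p v d))) })) e) (maj u c pu)
    ... | pu | yes a | yes refl = ℕ.≤-trans (ℕ.*-monoʳ-≤ 2 atMostOne) (proj₁ (room a pu))
      where
      onlyV : ∀ {x} → x ∈ filter (coloredAs? p′ u d) vertices → x ≡ v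
      onlyV {x} x∈ with ∈-filter⁻ (coloredAs? p′ u d) {xs = vertices} x∈
      ... | _ , ux , e = decidable-stable (x ≟ v) λ x≢v →
        proj₂ (room a pu) ux x≢v (trans (sym (update-other p v d x≢v)) e)

      atMostOne : neighborsColored p′ u d ≤ 1
      atMostOne = unique-constant⇒length≤1 (Unique.filter⁺ (coloredAs? p′ u d) unique) onlyV

  neighborsColored-disjoint : ∀ p v {c d} → c ≢ d →
    neighborsColored p v c + neighborsColored p v d ≤ deg v
  neighborsColored-disjoint p v {c} {d} c≢d =
    length-filter-disjoint (coloredAs? p v c) (coloredAs? p v d) (adj? v)
      (λ (_ , e) (_ , e′) → c≢d (just-injective (trans (sym e) e′))) proj₁ proj₁ vertices

  -- Two colours differ from `c`. They occupy disjoint sets of neighbours of `v`, so the rarer one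
  -- takes at most half of the degree.
  minority-color : ∀ p v c → ∃[ d ] (d ≢ c × 2 * neighborsColored p v d ≤ deg v)
  minority-color p v c with third c c
  ... | d , d≢c , _ with third c d
  ... | e , e≢c , e≢d with ℕ.≤-total (neighborsColored p v d) (neighborsColored p v e)
  ... | inj₁ d≤e = d , d≢c , 2*m≤o d≤e (neighborsColored-disjoint p v (λ d≡e → e≢d (sym d≡e)))
  ... | inj₂ e≤d = e , e≢c , 2*m≤o e≤d (neighborsColored-disjoint p v e≢d)

  color-avoiding : ∀ (p : Position) a → ∃[ c ] (∀ {d} → d ≢ c → p a ≢ just d)
  color-avoiding p a with p a
  ... | just c  = c , λ d≢c e → d≢c (sym (just-injective e))
  -- An uncolored vertex blocks nothing, so the colour to avoid is arbitrary.
  ... | nothing = zero , λ _ ()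

  legal-new : ∀ p v → Majority p → ¬ Old v → p v ≡ nothing → ∃[ d ] Legal p v d
  legal-new p v maj nv pv
    with color-avoiding p (NeighborPair.fst (pairs nv)) | color-avoiding p (NeighborPair.snd (pairs nv))
  ... | c , avoid-c | c′ , avoid-c′ with third c c′
  -- No neighbour of `v` has colour `d`: the count at `v` is zero and the condition on its
  -- neighbours is vacuous.
  ... | d , d≢c , d≢c′ = d , legal-intro p v d pv maj few (λ a e → ⊥-elim (unused a e))
    where
    unused : ∀ {w} → Adj v w → p w ≢ just d
    unused a with NeighborPair.only (pairs nv) a
    ... | inj₁ refl = avoid-c d≢c
    ... | inj₂ refl = avoid-c′ d≢c′

    few : 2 * neighborsColored p v d ≤ deg v
    few rewrite filter-none (coloredAs? p v d) {vertices}
      (All.universal (λ _ (a , e) → unused a e) vertices) = z≤n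

  -- When `x` is a neighbour of `v` of degree two, `y` is its second neighbour. Requiring `y` to be
  -- colored makes the property permanent, since colours never change.
  Safe : Position → V → V → Set
  Safe p v x = ∀ {y} → Adj x y → y ≢ v → p y ≢ nothing × p y ≢ p x

  -- `S` collects the neighbours that may be unsafe: it is empty after a move of Alice and contains
  -- only the vertex just colored after a move of Bob.
  SafeExcept : (V → Set) → Position → Set
  SafeExcept S p = ∀ {v x} → Old v → p v ≡ nothing → Adj v x → p x ≢ nothing → x ∉ S → Safe p v x

  Invariant : Position → Set
  Invariant = SafeExcept ∅

  safe-update : ∀ {p u d v x} → p u ≡ nothing → p x ≢ nothing → Safe p v x → Safe (p [ u ≔ d ]) v x
  safe-update {p} {u} {d} {v} {x} pu px safe {y} a y≢v
    rewrite update-other p u d {x} (λ { refl → px pu })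
          | update-other p u d {y} (λ { refl → proj₁ (safe a y≢v) pu })
    = safe a y≢v

  -- A colored vertex other than `u` was colored before, and its safety persists, so `u` is the only
  -- possible new exception.
  safeExcept-update : ∀ {S p u d} → p u ≡ nothing → SafeExcept S p →
    SafeExcept (S ∪ ｛ u ｝) (p [ u ≔ d ])
  safeExcept-update {S} {p} {u} {d} pu inv {v} {x} ov pv a px x∉ = safe-update pu px′
    (inv ov (proj₂ (update-uncolored p u d pv)) a px′ (λ x∈S → x∉ (inj₁ x∈S)))
    where
    px′ : p x ≢ nothing
    px′ eq = px (trans (update-other p u d λ { refl → x∉ (inj₂ refl) }) eq)

  -- The new exception `u` is old, hence never a neighbour of an old vertex.
  invariant-update-old : ∀ {p u d} → Old u → p u ≡ nothing → Invariant p → Invariant (p [ u ≔ d ])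
  invariant-update-old ou pu inv ov pv a px _ = safeExcept-update pu inv ov pv a px
    λ { (inj₂ refl) → old-independent ov ou a }

  -- Choosing `d` different from the colour of `w` means that every neighbour of `v` coloured `d` is
  -- safe, so coloring `v` gives it just one neighbour of its own colour. The same choice later
  -- makes `w` safe.
  legal-old : ∀ p w v → Majority p → SafeExcept ｛ w ｝ p → Old v → p v ≡ nothing →
    ∃[ d ] (Legal p v d × p w ≢ just d)
  legal-old p w v maj inv ov pv with color-avoiding p w
  ... | c , avoid with minority-color p v c
  ... | d , d≢c , few = d , legal-intro p v d pv maj few room , avoid d≢c
    where
    room : ∀ {x} → Adj v x → p x ≡ just d →
      2 ≤ deg x × (∀ {y} → Adj x y → y ≢ v → p y ≢ just d)
    room {x} a px = NeighborPair.2≤deg (pairs (old-neighbor ov a)) , λ a′ y≢v py →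
      proj₂ (inv ov pv a (colored≢uncolored {p} px) (λ { refl → avoid d≢c px }) a′ y≢v)
        (trans py (sym px))

  legal-move : ∀ p w v → Majority p → SafeExcept ｛ w ｝ p → p v ≡ nothing → ∃[ d ] Legal p v d
  legal-move p w v maj inv pv with old? v
  ... | yes ov = let (d , l , _) = legal-old p w v maj inv ov pv in d , l
  ... | no nv  = legal-new p v maj nv pv

  ¬bobHasWon : ∀ {p} w → Majority p → SafeExcept ｛ w ｝ p → ¬ BobHasWon p
  ¬bobHasWon {p} w maj inv (v , pv , stuck) =
    let (d , l) = legal-move p w v maj inv pv in stuck d l

  invariant⇒safeExcept : ∀ {p} w → Invariant p → SafeExcept ｛ w ｝ p
  invariant⇒safeExcept _ inv ov pv a px _ = inv ov pv a px (λ ())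

  -- If `w` has another uncolored old neighbour `v′`, then `v` is the second neighbour of `w` as
  -- seen from `v′`, and it now has a colour other than that of `w`.
  invariant-restored : ∀ {p w v d} → SafeExcept ｛ w ｝ p → p w ≢ nothing → Old v → Adj v w →
    p v ≡ nothing → p w ≢ just d → Invariant (p [ v ≔ d ])
  invariant-restored {p} {w} {v} {d} inv pw ov vw pv pw≢d {v′} {x} ov′ pv′ a px _ with x ≟ w
  ... | no x≢w   = safeExcept-update pv inv ov′ pv′ a px
    λ { (inj₁ refl) → x≢w refl ; (inj₂ refl) → old-independent ov′ ov a }
  ... | yes refl = safe
    where
    v≢v′ : v ≢ v′
    v≢v′ refl = proj₁ (update-uncolored p v d pv′) refl

    safe : Safe (p [ v ≔ d ]) v′ w
    safe a′ y≢v′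
      with NeighborPair.other (pairs (old-neighbor ov vw)) (adj-sym vw) (adj-sym a) a′ v≢v′ y≢v′
    ... | refl = colored≢uncolored {p [ v ≔ d ]} (update-same p v d) , λ eq →
      pw≢d (trans (sym (update-other p v d λ { refl → pw pv })) (trans (sym eq) (update-same p v d)))

  -- Old vertices come first, because coloring them preserves the invariant.
  quiet-reply : ∀ p → Majority p → Invariant p → (∃[ v ] p v ≡ nothing) →
    ∃[ v ] ∃[ d ] (Legal p v d × Invariant (p [ v ≔ d ]))
  quiet-reply p maj inv (u , pu) with ∃? finite (λ v → old? v ×-dec uncolored? p v)
  ... | yes (v , ov , pv) =
    -- There is no exception here, so `v` merely fills the slot of the exceptional vertex.
    let (d , l) = legal-move p v v maj (invariant⇒safeExcept v inv) pv
    in v , d , l , invariant-update-old ov pv inv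
  -- Once every old vertex is colored, the invariant is vacuous and any legal move will do.
  ... | no none =
    let (d , l) = legal-move p u u maj (invariant⇒safeExcept u inv) pu
    in u , d , l , λ ov pv → ⊥-elim (none (_ , ov , proj₂ (update-uncolored p u d pv)))

  reply : ∀ p w → Majority p → SafeExcept ｛ w ｝ p → (∃[ v ] p v ≡ nothing) →
    ∃[ v ] ∃[ d ] (Legal p v d × Invariant (p [ v ≔ d ]))
  reply p w maj inv some
    -- A threat is a colored `w` with an uncolored old neighbour. Without one the exception at `w`
    -- never arises, so the full invariant already holds.
    with ∃? finite (λ v → old? v ×-dec uncolored? p v ×-dec adj? v w ×-dec ¬? (uncolored? p w))
  ... | yes (v , ov , pv , vw , pw) =
    let (d , l , pw≢d) = legal-old p w v maj inv ov pv
    in v , d , l , invariant-restored inv pw ov vw pv pw≢d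
  ... | no ¬threat = quiet-reply p maj
    (λ ov pv a px _ → inv ov pv a px λ { refl → ¬threat (_ , ov , pv , a , px) }) some

  -- Alice's win by induction on the bound for the number of uncolored vertices.

  mutual
    aliceFrom : ∀ n p w → uncolored p < n → Majority p → SafeExcept ｛ w ｝ p → WinsFrom alice p
    aliceFrom (suc n) p w u<n maj inv with uncolored-vertex? p
    ... | no none = finished (¬uncolored⇒allColored none)
    ... | yes some =
      let (v , d , l , inv′) = reply p w maj inv some
      in aliceMove (¬bobHasWon w maj inv) v d l
           (bobFrom n (p [ v ≔ d ])
             (ℕ.<-≤-trans (uncolored-update p v d (proj₁ l)) (s≤s⁻¹ u<n)) (proj₂ l) inv′)

    bobFrom : ∀ n p → uncolored p < n → Majority p → Invariant p → WinsFrom bob p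
    bobFrom (suc n) p u<n maj inv with uncolored-vertex? p
    ... | no none = finished (¬uncolored⇒allColored none)
    ... | yes (u , _) = bobMove (¬bobHasWon u maj (invariant⇒safeExcept u inv)) λ v d l →
      aliceFrom n (p [ v ≔ d ]) v
        (ℕ.<-≤-trans (uncolored-update p v d (proj₁ l)) (s≤s⁻¹ u<n)) (proj₂ l)
        (λ ov pv a px x∉ → safeExcept-update (proj₁ l) inv ov pv a px λ { (inj₂ x∈) → x∉ x∈ })

  aliceWins : AliceWins G 3
  aliceWins with uncolored-vertex? initial
  ... | no none = finished (¬uncolored⇒allColored none)
  -- Before the first move nothing is colored, so both conditions are vacuous and any `w` can stand
  -- for Bob's last move.
  ... | yes (w , _) = aliceFrom (suc (uncolored initial)) initial w ℕ.≤-refl (λ _ _ ())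
    (λ _ _ _ px _ → ⊥-elim (px refl))

-- The subdivided graph

module _ (G : FiniteSimpleGraph) (s : FiniteSimpleGraph.Edge G → ℕ) where
  open FiniteSimpleGraph G
  open Edge
  open Subdivision G s hiding (subdivide)

  IsOld : SubVertex → Set
  IsOld x = ∃[ v ] x ≡ old v

  isOld? : Decidable IsOld
  isOld? (old v)   = yes (v , refl)
  isOld? (new _ _) = no λ ()

  -- Positivity of `s` enters here: it makes the old vertices independent.
  ¬direct : (∀ e → 1 ≤ s e) → ∀ {u v} → ¬ (old u ⟶ old v)
  ¬direct pos (direct e eq) = ℕ.<-irrefl (sym eq) (pos e)

  predecessor : ∀ e i → ∃[ x ] (x ⟶ new e i × (∀ {y} → y ⟶ new e i → y ≡ x))
  predecessor e i with toℕ i in eq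
  ... | zero  = old (src e) , enter e i eq , λ
    { (enter _ _ _) → refl
    ; (step _ _ _ q) → ⊥-elim (ℕ.0≢1+n (trans (sym eq) q)) }
  ... | suc m = new e j , step e j i (trans eq (cong suc (sym j≡m))) , λ
    { (enter _ _ z) → ⊥-elim (ℕ.0≢1+n (trans (sym z) eq))
    ; (step _ j′ _ q) → cong (new e)
        (Fin.toℕ-injective (trans (ℕ.suc-injective (trans (sym q) eq)) (sym j≡m))) }
    where
    m<s : m < s e
    m<s = ℕ.<-trans (ℕ.n<1+n m) (subst (_< s e) eq (Fin.toℕ<n i))
    j : Fin (s e)
    j = fromℕ< m<s
    j≡m : toℕ j ≡ m
    j≡m = Fin.toℕ-fromℕ< m<s

  successor : ∀ e i → ∃[ x ] (new e i ⟶ x × (∀ {y} → new e i ⟶ y → y ≡ x))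
  -- `Fin.toℕ<n i` reads `suc (toℕ i) ≤ s e`, with equality exactly at the last internal vertex of
  -- the path.
  successor e i with ℕ.m≤n⇒m<n∨m≡n (Fin.toℕ<n i)
  ... | inj₂ last = old (tgt e) , leave e i last , λ
    { (leave _ _ _) → refl
    ; (step _ _ j q) → ⊥-elim (ℕ.<-irrefl (trans q last) (Fin.toℕ<n j)) }
  ... | inj₁ 1+i<s = new e (fromℕ< 1+i<s) , step e i _ (Fin.toℕ-fromℕ< 1+i<s) , λ
    { (leave _ _ last) → ⊥-elim (ℕ.<-irrefl last 1+i<s)
    ; (step _ _ j q) → cong (new e) (Fin.toℕ-injective (trans q (sym (Fin.toℕ-fromℕ< 1+i<s)))) }

  enter-src : ∀ {u e i} → old u ⟶ new e i → src e ≡ u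
  enter-src (enter _ _ _) = refl

  leave-tgt : ∀ {u e i} → new e i ⟶ old u → tgt e ≡ u
  leave-tgt (leave _ _ _) = refl

  -- This separates the two neighbours of a new vertex. An old `x` would be both ends of `e`, a
  -- loop; a new `x` would have an index both below and above `i`.
  ⟶-asym-new : ∀ {x e i} → x ⟶ new e i → ¬ (new e i ⟶ x)
  ⟶-asym-new {old _} {e} x⟶ ⟶x = src≢tgt e (trans (enter-src x⟶) (sym (leave-tgt ⟶x)))
  ⟶-asym-new {new _ _} (step _ _ _ q) (step _ _ _ r) =
    ℕ.<-asym (ℕ.≤-reflexive (sym q)) (ℕ.≤-reflexive (sym r))

  neighborPair : ∀ {x} → ¬ IsOld x → NeighborPair (subdivide G s) x
  neighborPair {old v}   ¬old = ⊥-elim (¬old (v , refl))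
  neighborPair {new e i} _    with predecessor e i | successor e i
  ... | a , a⟶ , a-only | b , ⟶b , b-only = record
    { fst      = a
    ; snd      = b
    ; distinct = λ { refl → ⟶-asym-new a⟶ ⟶b }
    ; adj-fst  = inj₂ a⟶
    ; adj-snd  = inj₁ ⟶b
    ; only     = λ { (inj₁ ⟶x) → inj₂ (b-only ⟶x) ; (inj₂ x⟶) → inj₁ (a-only x⟶) }
    }

  aliceWins-subdivide : (∀ e → 1 ≤ s e) → AliceWins (subdivide G s) 3
  aliceWins-subdivide pos = Strategy.aliceWins (subdivide G s) IsOld isOld?
    (λ { (_ , refl) (_ , refl) (inj₁ r) → ¬direct pos r
       ; (_ , refl) (_ , refl) (inj₂ r) → ¬direct pos r })
    neighborPair

theorem7 : (G : FiniteSimpleGraph) (s : FiniteSimpleGraph.Edge G → ℕ) →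
    (∀ e → 1 ≤ s e) →
    ∃[ k ] (IsMajorityGameChromaticNumber (subdivide G s) k × k ≤ 3)
theorem7 G s pos =
  isLeast-≤ (Positions.aliceWins? (subdivide G s)) 3 (aliceWins-subdivide G s pos)
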